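{- There exists a probability distribution over instances of the improving multi-armed bandits problem (with $k$ arms and time horizon $T$) on which no deterministic algorithm can achieve expected reward greater than $\dfrac{3\,OPT}{\sqrt{k}}$.
   Context: An instance of the improving multi-armed bandits problem consists of $k$ arms; arm $i$ has a reward function $f_i$ that is nondecreasing, satisfies $f_i(0)=0$, and has diminishing returns: $f_i(t+1)-f_i(t)\le f_i(t)-f_i(t-1)$ for all $t\ge 1$. Pulling arm $i$ for the $t$-th time yields reward $f_i(t)$ (the argument is the number of times that arm has been pulled, not the global time). An algorithm pulls one arm per step for $T$ steps; it does not know the $f_i$ in advance and only observes the rewards of its own pulls. Its reward is the sum of the $T$ rewards obtained; the expectation in the claim is over the random instance. $OPT$ is the optimal reward, i.e. the reward of playing the best single arm for the whole horizon, $\max_i\sum_{t=1}^T f_i(t)$. -}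

module Defs where

open import Algebra.Bundles using (CommutativeRing)
open import Data.Fin.Base using (Fin; toℕ)
open import Data.Fin.Properties using (_≟_)
open import Data.List.Base using (List; []; _∷_; allFin; filter; foldr; length; map)
open import Data.Nat.Base as ℕ using (ℕ; zero; suc)
open import Data.Product.Base using (_×_; _,_; proj₁; proj₂)
open import Level using (Level; _⊔_) renaming (suc to lsuc)
open import Relation.Binary.Bundles using (TotalOrder)
open import Relation.Binary.Core using (Rel)
open import Relation.Binary.Structures using (IsTotalOrder)
open import Relation.Nullary.Negation using (¬_)
import Algebra.Definitions.RawMonoid as RawMonoidDefs
import Data.List.Extrema as Extrema
import Relation.Binary.Construct.NonStrictToStrict as ToStrict

-- Totally ordered fields in which every nonnegative element has a square
-- root.  The real numbers are the intended model; neither completeness nor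
-- the Archimedean property is assumed.
record EuclideanField (c ℓ₁ ℓ₂ : Level) : Set (lsuc (c ⊔ ℓ₁ ⊔ ℓ₂)) where
  infix  4 _≤_
  infixl 7 _/_
  infix  9 _⁻¹
  field
    commutativeRing : CommutativeRing c ℓ₁

  open CommutativeRing commutativeRing public

  field
    -- Both functions are total; their values at zero and at negative
    -- elements respectively are unspecified.
    _⁻¹          : Carrier → Carrier
    √            : Carrier → Carrier
    _≤_          : Rel Carrier ℓ₂
    isTotalOrder : IsTotalOrder _≈_ _≤_
    1≉0          : ¬ (1# ≈ 0#)
    ⁻¹-cong      : ∀ {x y} → x ≈ y → x ⁻¹ ≈ y ⁻¹
    ⁻¹-inverse   : ∀ x → ¬ (x ≈ 0#) → x * x ⁻¹ ≈ 1#
    +-monoˡ-≤    : ∀ z {x y} → x ≤ y → x + z ≤ y + z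
    *-nonNeg     : ∀ {x y} → 0# ≤ x → 0# ≤ y → 0# ≤ x * y
    √-cong       : ∀ {x y} → x ≈ y → √ x ≈ √ y
    √-nonNeg     : ∀ {x} → 0# ≤ x → 0# ≤ √ x
    √-square     : ∀ {x} → 0# ≤ x → √ x * √ x ≈ x

  totalOrder : TotalOrder c ℓ₁ ℓ₂
  totalOrder = record { isTotalOrder = isTotalOrder }

  open ToStrict _≈_ _≤_ public using (_<_)

  open RawMonoidDefs +-rawMonoid public using (sum) renaming (_×_ to _·_)

  _/_ : Carrier → Carrier → Carrier
  x / y = x * y ⁻¹

  fromℕ : ℕ → Carrier
  fromℕ n = n · 1#

module ImprovingBandits {c ℓ₁ ℓ₂} (F : EuclideanField c ℓ₁ ℓ₂) where
  open EuclideanField F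
  open Extrema totalOrder using (max)

  record RewardFunction : Set (c ⊔ ℓ₁ ⊔ ℓ₂) where
    field
      value       : ℕ → Carrier
      startsAt0   : value 0 ≈ 0#
      monotone    : ∀ {s t} → s ℕ.≤ t → value s ≤ value t
      diminishing : ∀ t → value (2 ℕ.+ t) - value (1 ℕ.+ t) ≤ value (1 ℕ.+ t) - value t

  open RewardFunction public

  Instance : ℕ → Set (c ⊔ ℓ₁ ⊔ ℓ₂)
  Instance k = Fin k → RewardFunction

  -- Past pulls with the rewards they yielded, most recent first.
  History : ℕ → Set c
  History k = List (Fin k × Carrier)

  -- Not required to respect _≈_ on the observed rewards, so this class
  -- contains all the extensional algorithms.
  Algorithm : ℕ → Set c
  Algorithm k = History k → Fin k

  pulls : ∀ {k} → Fin k → History k → ℕ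
  pulls i h = length (filter (λ p → proj₁ p ≟ i) h)

  play : ∀ {k} → Algorithm k → Instance k → (T : ℕ) → History k
  play A I zero    = []
  play A I (suc T) = (i , value (I i) (suc (pulls i h))) ∷ h
    where
    h = play A I T
    i = A h

  reward : ∀ {k} → ℕ → Algorithm k → Instance k → Carrier
  reward T A I = foldr (λ p r → proj₂ p + r) 0# (play A I T)

  armTotal : ℕ → RewardFunction → Carrier
  armTotal T f = sum {T} (λ t → value f (suc (toℕ t)))

  -- Arm totals are nonnegative, so for k ≥ 1 the initial value 0# does not
  -- affect the maximum.
  opt : ∀ {k} → ℕ → Instance k → Carrier
  opt {k} T I = max 0# (map (λ i → armTotal T (I i)) (allFin k))

  -- Finitely supported probability distributions.
  record Distribution {a} (A : Set a) : Set (a ⊔ c ⊔ ℓ₁ ⊔ ℓ₂) where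
    field
      size      : ℕ
      outcome   : Fin size → A
      weight    : Fin size → Carrier
      nonNeg    : ∀ j → 0# ≤ weight j
      sumsTo1   : sum weight ≈ 1#

  open Distribution public

  𝔼 : ∀ {a} {A : Set a} → Distribution A → (A → Carrier) → Carrier
  𝔼 μ X = sum (λ j → weight μ j * X (outcome μ j))

{-# OPTIONS --safe #-}

-- One arm, chosen uniformly at random, is good and pays t on its t-th pull;
-- every other arm pays min(t, m), where m = ⌊T/√k⌋.  Until the good arm has
-- been pulled more than m times the play coincides with the play against k
-- bad arms.  In that play at most T/(m+1) < √k arms are pulled more than m
-- times, so the good arm is discovered with probability at most 1/√k.
-- Otherwise every pull pays at most m, for a total of at most
-- T²/√k ≤ 2 OPT/√k.
module Submission where

open import Defs
open import Data.Bool.Base using (if_then_else_)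
open import Data.Fin.Base using (Fin; zero; suc; toℕ)
open import Data.Fin.Properties using (_≟_; toℕ-inject₁; toℕ-fromℕ)
open import Data.List.Base using ([]; _∷_; allFin; foldr; length; map)
open import Data.List.Properties using (length-filter)
open import Data.List.Membership.Propositional using (_∈_)
open import Data.List.Membership.Propositional.Properties using (∈-allFin; ∈-map⁺)
open import Data.List.Relation.Unary.All using (universal)
open import Data.List.Relation.Unary.All.Properties using (map⁺)
open import Data.Nat.Base as ℕ using (ℕ; zero; suc; NonZero; z≤n; s≤s; _⊓_)
open import Data.Nat.DivMod using (m/n*n≤m; m≥n⇒m/n>0)
import Data.Nat.Properties as ℕ
open import Data.Nat.Tactic.RingSolver using (solve-∀)
open import Data.Product.Base using (_×_; Σ-syntax; ∃-syntax; _,_; proj₁; proj₂)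
open import Data.Sum.Base using (inj₁; inj₂)
open import Relation.Binary.Bundles using (TotalOrder)
open import Relation.Nullary.Decidable using (does; yes; no)
open import Relation.Nullary.Negation using (¬_; contradiction)
open import Relation.Binary.PropositionalEquality as ≡ using (_≡_)
open import Algebra.Bundles using (Monoid)
import Algebra.Properties.CommutativeMonoid.Sum as CommutativeMonoidSum
import Algebra.Properties.Monoid.Sum as MonoidSum
import Algebra.Properties.Ring as RingProperties
import Algebra.Properties.Semiring.Mult as SemiringMult
import Algebra.Properties.Semiring.Sum as SemiringSum
import Algebra.Solver.Ring.NaturalCoefficients.Default as SemiringSolver
import Data.List.Extrema as Extrema
import Relation.Binary.Reasoning.PartialOrder as PosetReasoning

-- Sums and inequalities of natural numbers

module ℕΣ = CommutativeMonoidSum ℕ.+-0-commutativeMonoid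

module _ {a ℓ} (M : Monoid a ℓ) where
  open Monoid M
  open MonoidSum M using (sum; sum-init-last; sum-cong-≗)

  -- `sum` unfolds at its first index, whereas lengthening the horizon adds a term at the end. It is
  -- needed for sums both in `ℕ` and in the field, hence an arbitrary monoid.
  sum-toℕ-suc : ∀ (g : ℕ → Carrier) n →
    sum {suc n} (λ i → g (toℕ i)) ≈ sum {n} (λ i → g (toℕ i)) ∙ g n
  sum-toℕ-suc g n = trans (sum-init-last {n} (λ i → g (toℕ i)))
    (reflexive (≡.cong₂ _∙_
      (sum-cong-≗ {n} (λ i → ≡.cong g (toℕ-inject₁ i)))
      (≡.cong g (toℕ-fromℕ n))))

sumℕ-mono-≤ : ∀ {n} {f g : Fin n → ℕ} → (∀ i → f i ℕ.≤ g i) → ℕΣ.sum f ℕ.≤ ℕΣ.sum g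
sumℕ-mono-≤ {zero}  f≤g = z≤n
sumℕ-mono-≤ {suc n} f≤g = ℕ.+-mono-≤ (f≤g zero) (sumℕ-mono-≤ (λ i → f≤g (suc i)))

*-distribʳ-sumℕ : ∀ {n} (f : Fin n → ℕ) c → ℕΣ.sum f ℕ.* c ≡ ℕΣ.sum (λ i → f i ℕ.* c)
*-distribʳ-sumℕ {n} f c = SemiringSum.*-distribʳ-sum ℕ.+-*-semiring c f

triangular : ℕ → ℕ
triangular n = ℕΣ.sum {n} (λ i → suc (toℕ i))

n²≤2*triangular : ∀ n → n ℕ.* n ℕ.≤ 2 ℕ.* triangular n
n²≤2*triangular zero    = z≤n
n²≤2*triangular (suc n) = begin
  suc n ℕ.* suc n                 ≤⟨ ℕ.n≤1+n _ ⟩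
  suc (suc n ℕ.* suc n)           ≡⟨ expand n ⟩
  n ℕ.* n ℕ.+ 2 ℕ.* suc n         ≤⟨ ℕ.+-monoˡ-≤ (2 ℕ.* suc n) (n²≤2*triangular n) ⟩
  2 ℕ.* triangular n ℕ.+ 2 ℕ.* suc n  ≡⟨ ℕ.*-distribˡ-+ 2 (triangular n) (suc n) ⟨
  2 ℕ.* (triangular n ℕ.+ suc n)  ≡⟨ ≡.cong (2 ℕ.*_) (sum-toℕ-suc ℕ.+-0-monoid suc n) ⟨
  2 ℕ.* triangular (suc n)        ∎
  where
  open ℕ.≤-Reasoning
  expand : ∀ n → suc (suc n ℕ.* suc n) ≡ n ℕ.* n ℕ.+ 2 ℕ.* suc n
  expand = solve-∀

triangular-nonZero : ∀ n → .{{NonZero n}} → NonZero (triangular n)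
triangular-nonZero (suc n) = _

-- The integer part of the square root of `n / k`, given by two inequalities in `ℕ`. With `n` equal
-- to `T * T` it is the floor of T/√k, obtained without rounding a field element. When `n` grows by
-- one the root grows by at most one, so a linear search suffices.
⌊√[_/_]⌋ : ∀ n k → .{{NonZero k}} →
  ∃[ m ] m ℕ.* m ℕ.* k ℕ.≤ n × n ℕ.< suc m ℕ.* suc m ℕ.* k
⌊√[ zero / k ]⌋ = 0 , z≤n , ℕ.≤-trans (ℕ.>-nonZero⁻¹ k) (ℕ.m≤m+n k 0)
⌊√[ suc n / k ]⌋ with ⌊√[ n / k ]⌋
... | m , lower , upper with suc n ℕ.<? suc m ℕ.* suc m ℕ.* k
...   | yes below = m , ℕ.m≤n⇒m≤1+n lower , below
-- The old upper bound says that `suc n` is at most `suc m * suc m * k`, which is strictly below the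
-- next threshold because `k` is nonzero.
...   | no ¬below = suc m , ℕ.≮⇒≥ ¬below , ℕ.≤-<-trans upper
        (ℕ.*-monoˡ-< k (ℕ.*-mono-< (ℕ.n<1+n (suc m)) (ℕ.n<1+n (suc m))))

-- Squaring `N * M ≤ T` and cancelling `M * M` bounds `N` by √k while staying in `ℕ`. In the
-- application `M` is one more than the cap and `N` bounds the number of arms pulled at least `M`
-- times.
square-bound : ∀ N M T k → N ℕ.* M ℕ.≤ T → T ℕ.* T ℕ.< M ℕ.* M ℕ.* k → N ℕ.* N ℕ.≤ k
square-bound N M T k NM≤T T²<M²k = ℕ.<⇒≤ (ℕ.*-cancelˡ-< (M ℕ.* M) (N ℕ.* N) k (begin-strict
  M ℕ.* M ℕ.* (N ℕ.* N)     ≡⟨ rearrange M N ⟩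
  (N ℕ.* M) ℕ.* (N ℕ.* M)   ≤⟨ ℕ.*-mono-≤ NM≤T NM≤T ⟩
  T ℕ.* T                   <⟨ T²<M²k ⟩
  M ℕ.* M ℕ.* k             ∎))
  where
  open ℕ.≤-Reasoning
  rearrange : ∀ M N → M ℕ.* M ℕ.* (N ℕ.* N) ≡ (N ℕ.* M) ℕ.* (N ℕ.* M)
  rearrange = solve-∀

-- Diminishing returns of the capped arm, with the subtractions moved across. Away from the corners,
-- lowering both `t` and `m` by one takes two from each side.
⊓-concave : ∀ m t → (2 ℕ.+ t) ⊓ m ℕ.+ t ⊓ m ℕ.≤ (1 ℕ.+ t) ⊓ m ℕ.+ (1 ℕ.+ t) ⊓ m
⊓-concave zero    zero    = z≤n
⊓-concave zero    (suc t) = z≤n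
⊓-concave (suc m) zero    = s≤s (ℕ.+-mono-≤ (ℕ.m⊓n≤m 1 m) z≤n)
⊓-concave (suc m) (suc t) = s≤s (begin
  (2 ℕ.+ t) ⊓ m ℕ.+ suc (t ⊓ m)             ≡⟨ ℕ.+-suc _ _ ⟩
  suc ((2 ℕ.+ t) ⊓ m ℕ.+ t ⊓ m)             ≤⟨ s≤s (⊓-concave m t) ⟩
  suc ((1 ℕ.+ t) ⊓ m ℕ.+ (1 ℕ.+ t) ⊓ m)     ≡⟨ ℕ.+-suc _ _ ⟨
  (1 ℕ.+ t) ⊓ m ℕ.+ suc ((1 ℕ.+ t) ⊓ m)     ∎)
  where open ℕ.≤-Reasoning

kronecker : ∀ {k} → Fin k → Fin k → ℕ
kronecker i j = if does (i ≟ j) then 1 else 0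

sum-kronecker : ∀ {k} (i : Fin k) → ℕΣ.sum (kronecker i) ≡ 1
sum-kronecker {suc k} zero    = ≡.cong suc (ℕΣ.sum-replicate-zero k)
sum-kronecker {suc k} (suc i) = sum-kronecker i

-- Ordered field arithmetic and the embedding of the natural numbers

module OrderedField {c ℓ₁ ℓ₂} (F : EuclideanField c ℓ₁ ℓ₂) where
  open EuclideanField F hiding (zero) renaming (fromℕ to ι)
  open TotalOrder totalOrder public
    using (poset) renaming (refl to ≤-refl; trans to ≤-trans; antisym to ≤-antisym;
      total to ≤-total; reflexive to ≤-reflexive)
  open PosetReasoning poset
  open RingProperties ring using (-‿distribˡ-*; -‿distribʳ-*; -‿involutive)
  open SemiringMult semiring using (×-homo-+; ×1-homo-*)
  open SemiringSolver commutativeSemiring using (solve; _:+_; _:*_; _:=_)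

  +-mono-≤ : ∀ {w x y z} → w ≤ x → y ≤ z → w + y ≤ x + z
  +-mono-≤ {w} {x} {y} {z} w≤x y≤z = begin
    w + y ≤⟨ +-monoˡ-≤ y w≤x ⟩
    x + y ≈⟨ +-comm x y ⟩
    y + x ≤⟨ +-monoˡ-≤ x y≤z ⟩
    z + x ≈⟨ +-comm z x ⟩
    x + z ∎

  +-nonNeg : ∀ {x y} → 0# ≤ x → 0# ≤ y → 0# ≤ x + y
  +-nonNeg {x} {y} 0≤x 0≤y = begin
    0#      ≈⟨ +-identityˡ 0# ⟨
    0# + 0# ≤⟨ +-mono-≤ 0≤x 0≤y ⟩
    x + y   ∎

  x+z≤y+w⇒x-w≤y-z : ∀ x y z w → x + z ≤ y + w → x - w ≤ y - z
  x+z≤y+w⇒x-w≤y-z x y z w x+z≤y+w = begin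
    x - w                 ≈⟨ +-identityʳ _ ⟨
    x - w + 0#            ≈⟨ +-congˡ (-‿inverseʳ z) ⟨
    x - w + (z - z)       ≈⟨ solve 4 (λ x w′ z z′ → (x :+ w′) :+ (z :+ z′) := (x :+ z) :+ (w′ :+ z′)) refl x (- w) z (- z) ⟩
    x + z + (- w - z)     ≤⟨ +-monoˡ-≤ _ x+z≤y+w ⟩
    y + w + (- w - z)     ≈⟨ solve 4 (λ y w w′ z′ → (y :+ w) :+ (w′ :+ z′) := (y :+ z′) :+ (w :+ w′)) refl y w (- w) (- z) ⟩
    y - z + (w - w)       ≈⟨ +-congˡ (-‿inverseʳ w) ⟩
    y - z + 0#            ≈⟨ +-identityʳ _ ⟩
    y - z                 ∎

  x≤y⇒0≤y-x : ∀ {x y} → x ≤ y → 0# ≤ y - x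
  x≤y⇒0≤y-x {x} {y} x≤y = begin
    0#    ≈⟨ -‿inverseʳ x ⟨
    x - x ≤⟨ +-monoˡ-≤ (- x) x≤y ⟩
    y - x ∎

  *-monoˡ-≤ : ∀ {x y z} → 0# ≤ z → x ≤ y → z * x ≤ z * y
  *-monoˡ-≤ {x} {y} {z} 0≤z x≤y = begin
    z * x               ≈⟨ +-identityˡ _ ⟨
    0# + z * x          ≤⟨ +-monoˡ-≤ (z * x) (*-nonNeg 0≤z (x≤y⇒0≤y-x x≤y)) ⟩
    z * (y - x) + z * x ≈⟨ distribˡ z (y - x) x ⟨
    z * (y - x + x)     ≈⟨ *-congˡ (+-assoc y (- x) x) ⟩
    z * (y + (- x + x)) ≈⟨ *-congˡ (+-congˡ (-‿inverseˡ x)) ⟩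
    z * (y + 0#)        ≈⟨ *-congˡ (+-identityʳ y) ⟩
    z * y               ∎

  *-monoʳ-≤ : ∀ {x y z} → 0# ≤ z → x ≤ y → x * z ≤ y * z
  *-monoʳ-≤ {x} {y} {z} 0≤z x≤y = begin
    x * z ≈⟨ *-comm x z ⟩
    z * x ≤⟨ *-monoˡ-≤ 0≤z x≤y ⟩
    z * y ≈⟨ *-comm z y ⟩
    y * z ∎

  square-nonNeg : ∀ x → 0# ≤ x * x
  square-nonNeg x with ≤-total 0# x
  ... | inj₁ 0≤x = *-nonNeg 0≤x 0≤x
  ... | inj₂ x≤0 = begin
    0#            ≤⟨ *-nonNeg 0≤-x 0≤-x ⟩
    - x * - x     ≈⟨ -‿distribˡ-* x (- x) ⟨
    - (x * - x)   ≈⟨ -‿cong (-‿distribʳ-* x x) ⟨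
    - - (x * x)   ≈⟨ -‿involutive (x * x) ⟩
    x * x         ∎
    where
    0≤-x : 0# ≤ - x
    0≤-x = ≤-trans (x≤y⇒0≤y-x x≤0) (≤-reflexive (+-identityˡ (- x)))

  0≤1 : 0# ≤ 1#
  0≤1 = ≤-trans (square-nonNeg 1#) (≤-reflexive (*-identityˡ 1#))

  -- The inverse equals `x` times the square of the inverse, a product of nonnegative factors.
  ⁻¹-nonNeg : ∀ {x} → 0# ≤ x → ¬ (x ≈ 0#) → 0# ≤ x ⁻¹
  ⁻¹-nonNeg {x} 0≤x x≉0 = begin
    0#                ≤⟨ *-nonNeg 0≤x (square-nonNeg (x ⁻¹)) ⟩
    x * (x ⁻¹ * x ⁻¹) ≈⟨ *-assoc _ _ _ ⟨
    x * x ⁻¹ * x ⁻¹   ≈⟨ *-congʳ (⁻¹-inverse x x≉0) ⟩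
    1# * x ⁻¹         ≈⟨ *-identityˡ _ ⟩
    x ⁻¹              ∎

  *-cancelʳ-≤ : ∀ {x y z} → 0# ≤ z → ¬ (z ≈ 0#) → x * z ≤ y * z → x ≤ y
  *-cancelʳ-≤ {x} {y} {z} 0≤z z≉0 xz≤yz = begin
    x              ≈⟨ cancel x ⟨
    x * z * z ⁻¹   ≤⟨ *-monoʳ-≤ (⁻¹-nonNeg 0≤z z≉0) xz≤yz ⟩
    y * z * z ⁻¹   ≈⟨ cancel y ⟩
    y              ∎
    where
    cancel : ∀ x → x * z * z ⁻¹ ≈ x
    cancel x = trans (*-assoc x z (z ⁻¹))
      (trans (*-congˡ (⁻¹-inverse z z≉0)) (*-identityʳ x))

  -- Adding `x * y` to both sides of the hypothesis gives `x * (x + y) ≤ y * (x + y)`, and `x + y`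
  -- is nonzero because it is at least `y`. This turns inequalities between natural numbers into
  -- inequalities involving `√`.
  square-cancel-≤ : ∀ {x y} → 0# ≤ x → 0# ≤ y → ¬ (y ≈ 0#) → x * x ≤ y * y → x ≤ y
  square-cancel-≤ {x} {y} 0≤x 0≤y y≉0 x²≤y² =
    *-cancelʳ-≤ (+-nonNeg 0≤x 0≤y) x+y≉0 (begin
      x * (x + y)    ≈⟨ distribˡ x x y ⟩
      x * x + x * y  ≤⟨ +-monoˡ-≤ (x * y) x²≤y² ⟩
      y * y + x * y  ≈⟨ solve 2 (λ x y → y :* y :+ x :* y := y :* (x :+ y)) refl x y ⟩
      y * (x + y)    ∎)
    where
    x+y≉0 : ¬ (x + y ≈ 0#)
    x+y≉0 x+y≈0 = y≉0 (≤-antisym (begin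
      y       ≈⟨ +-identityˡ y ⟨
      0# + y  ≤⟨ +-monoˡ-≤ y 0≤x ⟩
      x + y   ≈⟨ x+y≈0 ⟩
      0#      ∎) 0≤y)

  ι-homo-+ : ∀ m n → ι (m ℕ.+ n) ≈ ι m + ι n
  ι-homo-+ = ×-homo-+ 1#

  ι-homo-* : ∀ m n → ι (m ℕ.* n) ≈ ι m * ι n
  ι-homo-* = ×1-homo-*

  ι-nonNeg : ∀ n → 0# ≤ ι n
  ι-nonNeg zero    = ≤-refl
  ι-nonNeg (suc n) = +-nonNeg 0≤1 (ι-nonNeg n)

  ι-mono-≤ : ∀ {m n} → m ℕ.≤ n → ι m ≤ ι n
  ι-mono-≤ {n = n} z≤n = ι-nonNeg n
  ι-mono-≤ (s≤s m≤n)   = +-mono-≤ ≤-refl (ι-mono-≤ m≤n)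

  -- The order forces characteristic zero: a vanishing `ι n` would give `1# ≤ 0#`.
  ι≉0 : ∀ n → .{{NonZero n}} → ¬ (ι n ≈ 0#)
  ι≉0 (suc n) ιn≈0 = 1≉0 (≤-antisym (begin
    1#       ≈⟨ +-identityʳ 1# ⟨
    ι 1      ≤⟨ ι-mono-≤ (s≤s (z≤n {n})) ⟩
    ι (suc n) ≈⟨ ιn≈0 ⟩
    0#       ∎) 0≤1)

  ι-sum : ∀ {n} (f : Fin n → ℕ) → ι (ℕΣ.sum f) ≈ sum (λ i → ι (f i))
  ι-sum {zero}  f = refl
  ι-sum {suc n} f = trans (ι-homo-+ (f zero) _) (+-congˡ (ι-sum (λ i → f (suc i))))

  sum-mono-≤ : ∀ {n} {f g : Fin n → Carrier} → (∀ i → f i ≤ g i) → sum f ≤ sum g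
  sum-mono-≤ {zero}  f≤g = ≤-refl
  sum-mono-≤ {suc n} f≤g = +-mono-≤ (f≤g zero) (sum-mono-≤ (λ i → f≤g (suc i)))

  sum-const : ∀ n x → sum {n} (λ _ → x) ≈ ι n * x
  sum-const zero    x = sym (zeroˡ x)
  sum-const (suc n) x = begin-equality
    x + sum {n} (λ _ → x) ≈⟨ +-cong (sym (*-identityˡ x)) (sum-const n x) ⟩
    1# * x + ι n * x      ≈⟨ distribʳ x 1# (ι n) ⟨
    ι (suc n) * x         ∎

-- Counting pulls in a history

module PullCounts {c ℓ₁ ℓ₂} (F : EuclideanField c ℓ₁ ℓ₂) {k : ℕ} where
  open ImprovingBandits F

  pulls-∷ : ∀ j p (h : History k) → pulls j (p ∷ h) ≡ kronecker (proj₁ p) j ℕ.+ pulls j h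
  pulls-∷ j p h with proj₁ p ≟ j
  ... | yes _ = ≡.refl
  ... | no  _ = ≡.refl

  pulls-∷-≤ : ∀ j p (h : History k) → pulls j h ℕ.≤ pulls j (p ∷ h)
  pulls-∷-≤ j p h = ≡.subst (pulls j h ℕ.≤_) (≡.sym (pulls-∷ j p h)) (ℕ.m≤n+m _ _)

  pulls-∷-self : ∀ j x (h : History k) → pulls j ((j , x) ∷ h) ≡ suc (pulls j h)
  pulls-∷-self j x h with j ≟ j
  ... | yes _  = ≡.refl
  ... | no j≢j = contradiction ≡.refl j≢j

  sum-pulls : ∀ (h : History k) → ℕΣ.sum (λ j → pulls j h) ≡ length h
  sum-pulls []      = ℕΣ.sum-replicate-zero k
  sum-pulls (p ∷ h) = begin-equality
    ℕΣ.sum (λ j → pulls j (p ∷ h))                        ≡⟨ ℕΣ.sum-cong-≗ (λ j → pulls-∷ j p h) ⟩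
    ℕΣ.sum (λ j → kronecker (proj₁ p) j ℕ.+ pulls j h)    ≡⟨ ℕΣ.∑-distrib-+ (kronecker (proj₁ p)) (λ j → pulls j h) ⟩
    ℕΣ.sum (kronecker (proj₁ p)) ℕ.+ ℕΣ.sum (λ j → pulls j h) ≡⟨ ≡.cong₂ ℕ._+_ (sum-kronecker (proj₁ p)) (sum-pulls h) ⟩
    suc (length h)                                        ∎
    where open ℕ.≤-Reasoning

  -- Each quotient times `d` is at most the pull count of its arm, and every entry of the history is
  -- a pull of exactly one arm.
  sum-pulls/-≤ : ∀ (h : History k) d → .{{_ : NonZero d}} →
    ℕΣ.sum (λ j → pulls j h ℕ./ d) ℕ.* d ℕ.≤ length h
  sum-pulls/-≤ h d = begin
    ℕΣ.sum (λ j → pulls j h ℕ./ d) ℕ.* d    ≡⟨ *-distribʳ-sumℕ (λ j → pulls j h ℕ./ d) d ⟩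
    ℕΣ.sum (λ j → pulls j h ℕ./ d ℕ.* d)    ≤⟨ sumℕ-mono-≤ (λ j → m/n*n≤m (pulls j h) d) ⟩
    ℕΣ.sum (λ j → pulls j h)                ≡⟨ sum-pulls h ⟩
    length h                                ∎
    where open ℕ.≤-Reasoning

-- The hard instances and their reward functions

module HardInstances {c ℓ₁ ℓ₂} (F : EuclideanField c ℓ₁ ℓ₂) where
  open EuclideanField F hiding (zero) renaming (fromℕ to ι)
  open ImprovingBandits F
  open OrderedField F
  open PullCounts F
  open Extrema totalOrder using (max≈v⁺)
  open PosetReasoning poset
  open CommutativeMonoidSum +-commutativeMonoid using (∑-distrib-+)
  open SemiringSum semiring using (*-distribˡ-sum; *-distribʳ-sum)
  open SemiringSolver commutativeSemiring using (solve; _:+_; _:*_; _:=_)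

  linearArm : RewardFunction
  linearArm = record
    { value       = ι
    ; startsAt0   = refl
    ; monotone    = ι-mono-≤
    ; diminishing = λ t → x+z≤y+w⇒x-w≤y-z _ _ _ _
        (≤-reflexive (solve 2 (λ o x → (o :+ (o :+ x)) :+ x := (o :+ x) :+ (o :+ x)) refl 1# (ι t)))
    }

  cappedArm : ℕ → RewardFunction
  cappedArm m = record
    { value       = λ t → ι (t ⊓ m)
    ; startsAt0   = refl
    ; monotone    = λ s≤t → ι-mono-≤ (ℕ.⊓-monoˡ-≤ m s≤t)
    ; diminishing = λ t → x+z≤y+w⇒x-w≤y-z _ _ _ _ (begin
        ι ((2 ℕ.+ t) ⊓ m) + ι (t ⊓ m)             ≈⟨ ι-homo-+ ((2 ℕ.+ t) ⊓ m) (t ⊓ m) ⟨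
        ι ((2 ℕ.+ t) ⊓ m ℕ.+ t ⊓ m)               ≤⟨ ι-mono-≤ (⊓-concave m t) ⟩
        ι ((1 ℕ.+ t) ⊓ m ℕ.+ (1 ℕ.+ t) ⊓ m)       ≈⟨ ι-homo-+ ((1 ℕ.+ t) ⊓ m) ((1 ℕ.+ t) ⊓ m) ⟩
        ι ((1 ℕ.+ t) ⊓ m) + ι ((1 ℕ.+ t) ⊓ m)     ∎)
    }

  armTotal-nonNeg : ∀ f T → 0# ≤ armTotal T f
  armTotal-nonNeg f T = begin
    0#               ≈⟨ zeroʳ (ι T) ⟨
    ι T * 0#         ≈⟨ sum-const T 0# ⟨
    sum {T} (λ _ → 0#) ≤⟨ sum-mono-≤ {T} (λ t → ≤-trans (≤-reflexive (sym (startsAt0 f))) (monotone f z≤n)) ⟩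
    armTotal T f     ∎

  module _ {k : ℕ} where

    allCapped : ℕ → Instance k
    allCapped m _ = cappedArm m

    oneLinear : ℕ → Fin k → Instance k
    oneLinear m j i = if does (i ≟ j) then linearArm else cappedArm m

    value-oneLinear-≤ : ∀ m j i n → value (oneLinear m j i) n ≤ ι n
    value-oneLinear-≤ m j i n with i ≟ j
    ... | yes _ = ≤-refl
    ... | no  _ = ι-mono-≤ (ℕ.m⊓n≤m n m)

    -- Up to `m` pulls the cap is not felt, so good and bad arms look alike. The bound on `n` is
    -- asked for only at the good arm.
    value-oneLinear-≡ : ∀ m j i {n} → (i ≡ j → n ℕ.≤ m) →
      value (oneLinear m j i) n ≡ value (cappedArm m) n
    value-oneLinear-≡ m j i n≤m with i ≟ j
    ... | yes i≡j = ≡.cong ι (≡.sym (ℕ.m≤n⇒m⊓n≡m (n≤m i≡j)))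
    ... | no  _   = ≡.refl

    oneLinear-self : ∀ m j → oneLinear m j j ≡ linearArm
    oneLinear-self m j with j ≟ j
    ... | yes _  = ≡.refl
    ... | no j≢j = contradiction ≡.refl j≢j

    -- Rewards of a fixed algorithm, with and without discovery of the good arm

    module _ (A : Algorithm k) where

      length-play : ∀ I T → length (play A I T) ≡ T
      length-play I zero    = ≡.refl
      length-play I (suc T) = ≡.cong suc (length-play I T)

      pulls-play-≤ : ∀ I i T → pulls i (play A I T) ℕ.≤ T
      pulls-play-≤ I i T = ≡.subst (pulls i (play A I T) ℕ.≤_) (length-play I T)
        (length-filter (λ p → proj₁ p ≟ i) (play A I T))

      -- After `t` steps no arm has more than `t` pulls, so a bound on values by pull count becomes
      -- a bound by global time. It is applied with a constant `b` for capped arms and with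
      -- `ι (suc t)` for the good arm.
      reward-≤ : ∀ I (b : ℕ → Carrier) →
        (∀ i {n t} → n ℕ.≤ t → value (I i) (suc n) ≤ b t) →
        ∀ T → reward T A I ≤ sum {T} (λ t → b (toℕ t))
      reward-≤ I b value≤b zero    = ≤-refl
      reward-≤ I b value≤b (suc T) = begin
        value (I i) (suc (pulls i h)) + reward T A I  ≤⟨ +-mono-≤ (value≤b i (pulls-play-≤ I i T)) (reward-≤ I b value≤b T) ⟩
        b T + sum {T} (λ t → b (toℕ t))               ≈⟨ +-comm _ _ ⟩
        sum {T} (λ t → b (toℕ t)) + b T               ≈⟨ sum-toℕ-suc +-monoid b T ⟨
        sum {suc T} (λ t → b (toℕ t))                 ∎
        where
        h = play A I T
        i = A h

      reward-allCapped-≤ : ∀ m T → reward T A (allCapped m) ≤ ι T * ι m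
      reward-allCapped-≤ m T = begin
        reward T A (allCapped m) ≤⟨ reward-≤ (allCapped m) (λ _ → ι m) (λ _ {n} _ → ι-mono-≤ (ℕ.m⊓n≤n (suc n) m)) T ⟩
        sum {T} (λ _ → ι m)      ≈⟨ sum-const T (ι m) ⟩
        ι T * ι m                ∎

      reward-oneLinear-≤ : ∀ m j T → reward T A (oneLinear m j) ≤ armTotal T linearArm
      reward-oneLinear-≤ m j T = reward-≤ (oneLinear m j) (λ t → ι (suc t))
        (λ i {n} n≤t → ≤-trans (value-oneLinear-≤ m j i (suc n)) (ι-mono-≤ (s≤s n≤t))) T

      -- The algorithm is deterministic, so equal histories lead to the same next arm, and the
      -- rewards agree while arm `j` is within the cap. The condition concerns the play against
      -- `allCapped`, which is the same for every `j`. The equality is propositional because an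
      -- `Algorithm` need not respect `_≈_`.
      play-oneLinear : ∀ m j T → pulls j (play A (allCapped m) T) ℕ.≤ m →
        play A (oneLinear m j) T ≡ play A (allCapped m) T
      play-oneLinear m j zero    _       = ≡.refl
      play-oneLinear m j (suc T) pulls≤m = ≡.trans
        (≡.cong (λ h → (A h , value (oneLinear m j (A h)) (suc (pulls (A h) h))) ∷ h)
          (play-oneLinear m j T (ℕ.≤-trans (pulls-∷-≤ j p h) pulls≤m)))
        (≡.cong (λ x → (A h , x) ∷ h)
          -- If the arm now pulled is `j`, this pull is already counted in the hypothesis, so its
          -- index is at most `m`.
          (value-oneLinear-≡ m j (A h) λ { ≡.refl →
            ≡.subst (ℕ._≤ m) (pulls-∷-self (A h) (proj₂ p) h) pulls≤m }))
        where
        h = play A (allCapped m) T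
        p = A h , value (cappedArm m) (suc (pulls (A h) h))

      -- The quotient is ≥ 1 exactly when arm j is pulled more than m times, so it
      -- dominates the indicator of that event and sums to at most T/(m+1).
      discoveryBound : ℕ → ℕ → Fin k → ℕ
      discoveryBound m T j = pulls j (play A (allCapped m) T) ℕ./ suc m

      sum-discoveryBound-≤ : ∀ m T → ℕΣ.sum (discoveryBound m T) ℕ.* suc m ℕ.≤ T
      sum-discoveryBound-≤ m T =
        ≡.subst (ℕΣ.sum (discoveryBound m T) ℕ.* suc m ℕ.≤_) (length-play (allCapped m) T)
          (sum-pulls/-≤ (play A (allCapped m) T) (suc m))

      -- An undiscovered good arm leaves the reward of the capped play, which the first term bounds.
      -- Otherwise `discoveryBound` is at least one and the second term alone bounds any reward.
      -- Both terms are nonnegative, so their sum covers both cases.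
      reward-oneLinear-≤-discovered : ∀ m j T →
        reward T A (oneLinear m j) ≤ ι T * ι m + ι (discoveryBound m T j) * armTotal T linearArm
      reward-oneLinear-≤-discovered m j T with pulls j (play A (allCapped m) T) ℕ.≤? m
      ... | yes pulls≤m = begin
        reward T A (oneLinear m j)  ≡⟨ ≡.cong (foldr (λ p r → proj₂ p + r) 0#) (play-oneLinear m j T pulls≤m) ⟩
        reward T A (allCapped m)    ≤⟨ reward-allCapped-≤ m T ⟩
        ι T * ι m                   ≈⟨ +-identityʳ _ ⟨
        ι T * ι m + 0#              ≤⟨ +-mono-≤ ≤-refl (*-nonNeg (ι-nonNeg (discoveryBound m T j)) (armTotal-nonNeg linearArm T)) ⟩
        ι T * ι m + ι (discoveryBound m T j) * armTotal T linearArm ∎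
      ... | no pulls≰m = begin
        reward T A (oneLinear m j)      ≤⟨ reward-oneLinear-≤ m j T ⟩
        armTotal T linearArm            ≈⟨ +-identityˡ _ ⟨
        0# + armTotal T linearArm       ≈⟨ +-congˡ (*-identityˡ _) ⟨
        0# + 1# * armTotal T linearArm  ≤⟨ +-mono-≤ (*-nonNeg (ι-nonNeg T) (ι-nonNeg m)) (*-monoʳ-≤ (armTotal-nonNeg linearArm T) 1≤discovered) ⟩
        ι T * ι m + ι (discoveryBound m T j) * armTotal T linearArm ∎
        where
        1≤discovered : 1# ≤ ι (discoveryBound m T j)
        1≤discovered = ≤-trans (≤-reflexive (sym (+-identityʳ 1#))) (ι-mono-≤ (m≥n⇒m/n>0 (ℕ.≰⇒> pulls≰m)))

  -- The optimum of a hard instance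

  armTotal-linear : ∀ T → armTotal T linearArm ≈ ι (triangular T)
  armTotal-linear T = sym (ι-sum (λ i → suc (toℕ {T} i)))

  -- Rules out the degenerate situation in which all rewards vanish.
  armTotal-linear-positive : ∀ T → .{{NonZero T}} → 0# < armTotal T linearArm
  armTotal-linear-positive T = armTotal-nonNeg linearArm T ,
    λ 0≈total → ι≉0 (triangular T) {{triangular-nonZero T}}
      (trans (sym (armTotal-linear T)) (sym 0≈total))

  -- The good arm is pointwise at least as large as every other. The value does not depend on `j`,
  -- so OPT is one constant over the whole support.
  opt-oneLinear : ∀ {k} m (j : Fin k) T → opt T (oneLinear m j) ≈ armTotal T linearArm
  opt-oneLinear {k} m j T = max≈v⁺
    (≡.subst (_∈ totals) (≡.cong (armTotal T) (oneLinear-self m j)) (∈-map⁺ (λ i → armTotal T (oneLinear m j i)) (∈-allFin j)))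
    (map⁺ (universal (λ i → sum-mono-≤ {T} (λ t → value-oneLinear-≤ m j i (suc (toℕ t)))) (allFin k)))
    -- The maximum starts from `0#`, which must also lie below the total of the good arm.
    (armTotal-nonNeg linearArm T)
    where totals = map (λ i → armTotal T (oneLinear m j i)) (allFin k)

  -- The uniform distribution and the choice of the cap

  module _ (k T : ℕ) .{{_ : NonZero k}} .{{_ : NonZero T}} where

    OPT √k √k⁻¹ : Carrier
    OPT  = armTotal T linearArm
    √k   = √ (ι k)
    √k⁻¹ = √k ⁻¹

    cap : ℕ
    cap = proj₁ ⌊√[ T ℕ.* T / k ]⌋

    √k-nonNeg : 0# ≤ √k
    √k-nonNeg = √-nonNeg (ι-nonNeg k)

    √k*√k≈k : √k * √k ≈ ι k
    √k*√k≈k = √-square (ι-nonNeg k)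

    √k≉0 : ¬ (√k ≈ 0#)
    √k≉0 √k≈0 = ι≉0 k (trans (sym √k*√k≈k) (trans (*-congʳ √k≈0) (zeroˡ √k)))

    √k⁻¹-nonNeg : 0# ≤ √k⁻¹
    √k⁻¹-nonNeg = ⁻¹-nonNeg √k-nonNeg √k≉0

    √k*√k⁻¹≈1 : √k * √k⁻¹ ≈ 1#
    √k*√k⁻¹≈1 = ⁻¹-inverse √k √k≉0

    k*√k⁻²≈1 : ι k * (√k⁻¹ * √k⁻¹) ≈ 1#
    k*√k⁻²≈1 = begin-equality
      ι k * (√k⁻¹ * √k⁻¹)       ≈⟨ *-congʳ √k*√k≈k ⟨
      √k * √k * (√k⁻¹ * √k⁻¹)   ≈⟨ solve 2 (λ s r → (s :* s) :* (r :* r) := (s :* r) :* (s :* r)) refl √k √k⁻¹ ⟩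
      √k * √k⁻¹ * (√k * √k⁻¹)   ≈⟨ *-cong √k*√k⁻¹≈1 √k*√k⁻¹≈1 ⟩
      1# * 1#                   ≈⟨ *-identityˡ 1# ⟩
      1#                        ∎

    -- The weight 1/k is written (1/√k)², the form in which it is cancelled.
    uniform : Distribution (Instance k)
    uniform = record
      { size    = k
      ; outcome = oneLinear cap
      ; weight  = λ _ → √k⁻¹ * √k⁻¹
      ; nonNeg  = λ _ → square-nonNeg √k⁻¹
      ; sumsTo1 = trans (sum-const k _) k*√k⁻²≈1
      }

    cap≤T/√k : ι cap ≤ ι T * √k⁻¹
    cap≤T/√k = begin
      ι cap                 ≈⟨ *-identityʳ _ ⟨
      ι cap * 1#            ≈⟨ *-congˡ √k*√k⁻¹≈1 ⟨
      ι cap * (√k * √k⁻¹)   ≈⟨ *-assoc _ _ _ ⟨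
      ι cap * √k * √k⁻¹     ≤⟨ *-monoʳ-≤ √k⁻¹-nonNeg (square-cancel-≤ (*-nonNeg (ι-nonNeg cap) √k-nonNeg) (ι-nonNeg T) (ι≉0 T) squares) ⟩
      ι T * √k⁻¹            ∎
      where
      squares : ι cap * √k * (ι cap * √k) ≤ ι T * ι T
      squares = begin
        ι cap * √k * (ι cap * √k)   ≈⟨ solve 2 (λ m s → (m :* s) :* (m :* s) := (m :* m) :* (s :* s)) refl (ι cap) √k ⟩
        ι cap * ι cap * (√k * √k)   ≈⟨ *-cong (sym (ι-homo-* cap cap)) √k*√k≈k ⟩
        ι (cap ℕ.* cap) * ι k       ≈⟨ ι-homo-* (cap ℕ.* cap) k ⟨
        ι (cap ℕ.* cap ℕ.* k)       ≤⟨ ι-mono-≤ (proj₁ (proj₂ ⌊√[ T ℕ.* T / k ]⌋)) ⟩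
        ι (T ℕ.* T)                 ≈⟨ ι-homo-* T T ⟩
        ι T * ι T                   ∎

    -- OPT is the triangular number T(T+1)/2.
    T²≤2*OPT : ι T * ι T ≤ ι 2 * OPT
    T²≤2*OPT = begin
      ι T * ι T                ≈⟨ ι-homo-* T T ⟨
      ι (T ℕ.* T)              ≤⟨ ι-mono-≤ (n²≤2*triangular T) ⟩
      ι (2 ℕ.* triangular T)   ≈⟨ ι-homo-* 2 (triangular T) ⟩
      ι 2 * ι (triangular T)   ≈⟨ *-congˡ (armTotal-linear T) ⟨
      ι 2 * OPT                ∎

    -- The bound on the expected reward

    module _ (A : Algorithm k) where

      discoveries : ℕ
      discoveries = ℕΣ.sum (discoveryBound A cap T)

      -- Here the upper bound defining `cap` enters: `discoveries * suc cap` is at most `T`, while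
      -- `suc cap` exceeds T/√k.
      discoveries≤√k : ι discoveries ≤ √k
      discoveries≤√k = square-cancel-≤ (ι-nonNeg discoveries) √k-nonNeg √k≉0 (begin
        ι discoveries * ι discoveries    ≈⟨ ι-homo-* discoveries discoveries ⟨
        ι (discoveries ℕ.* discoveries)  ≤⟨ ι-mono-≤ (square-bound discoveries (suc cap) T k (sum-discoveryBound-≤ A cap T) (proj₂ (proj₂ ⌊√[ T ℕ.* T / k ]⌋))) ⟩
        ι k                              ≈⟨ √k*√k≈k ⟨
        √k * √k                          ∎)

      sum-reward-≤ : sum (λ j → reward T A (oneLinear cap j)) ≤
        ι k * (ι T * ι cap) + ι discoveries * OPT
      sum-reward-≤ = begin
        sum (λ j → reward T A (oneLinear cap j))                                ≤⟨ sum-mono-≤ (λ j → reward-oneLinear-≤-discovered A cap j T) ⟩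
        sum (λ j → ι T * ι cap + ι (discoveryBound A cap T j) * OPT)           ≈⟨ ∑-distrib-+ {k} (λ _ → ι T * ι cap) (λ j → ι (discoveryBound A cap T j) * OPT) ⟩
        sum {k} (λ _ → ι T * ι cap) + sum (λ j → ι (discoveryBound A cap T j) * OPT) ≈⟨ +-cong (sum-const k _) (sym (*-distribʳ-sum OPT (λ j → ι (discoveryBound A cap T j)))) ⟩
        ι k * (ι T * ι cap) + sum (λ j → ι (discoveryBound A cap T j)) * OPT   ≈⟨ +-congˡ (*-congʳ (ι-sum (discoveryBound A cap T))) ⟨
        ι k * (ι T * ι cap) + ι discoveries * OPT                               ∎

      -- The constant 3 is 2 + 1. Play without discovery contributes at most T²/√k, hence 2 OPT/√k;
      -- discovery contributes at most OPT for √k arms out of `k`, hence OPT/√k.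
      expected-reward-≤ : 𝔼 uniform (reward T A) ≤ ι 3 * OPT * √k⁻¹
      expected-reward-≤ = begin
        𝔼 uniform (reward T A)                            ≈⟨ *-distribˡ-sum (r * r) (λ j → reward T A (oneLinear cap j)) ⟨
        r * r * sum (λ j → reward T A (oneLinear cap j))  ≤⟨ *-monoˡ-≤ (square-nonNeg r) sum-reward-≤ ⟩
        r * r * (ι k * (t * ι cap) + ι discoveries * OPT) ≤⟨ *-monoˡ-≤ (square-nonNeg r) (+-mono-≤
                                                               (*-monoˡ-≤ (ι-nonNeg k) (*-monoˡ-≤ (ι-nonNeg T) cap≤T/√k))
                                                               (*-monoʳ-≤ (armTotal-nonNeg linearArm T) discoveries≤√k)) ⟩
        -- The regrouping isolates `ι k * (r * r)` and `√k * r`, each of which equals one.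
        r * r * (ι k * (t * (t * r)) + √k * OPT)          ≈⟨ solve 5 (λ r k t s o →
                                                               (r :* r) :* (k :* (t :* (t :* r)) :+ s :* o) :=
                                                               (k :* (r :* r)) :* ((t :* t) :* r) :+ (s :* r) :* (o :* r))
                                                               refl r (ι k) t √k OPT ⟩
        ι k * (r * r) * (t * t * r) + √k * r * (OPT * r)  ≈⟨ +-cong (*-congʳ k*√k⁻²≈1) (*-congʳ √k*√k⁻¹≈1) ⟩
        1# * (t * t * r) + 1# * (OPT * r)                 ≈⟨ +-cong (*-identityˡ _) (*-identityˡ _) ⟩
        t * t * r + OPT * r                               ≈⟨ distribʳ r (t * t) OPT ⟨
        (t * t + OPT) * r                                 ≤⟨ *-monoʳ-≤ √k⁻¹-nonNeg (+-mono-≤ T²≤2*OPT ≤-refl) ⟩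
        (ι 2 * OPT + OPT) * r                             ≈⟨ *-congʳ (+-comm (ι 2 * OPT) OPT) ⟩
        (OPT + ι 2 * OPT) * r                             ≈⟨ *-congʳ (+-congʳ (*-identityˡ OPT)) ⟨
        (1# * OPT + ι 2 * OPT) * r                        ≈⟨ *-congʳ (distribʳ OPT 1# (ι 2)) ⟨
        ι 3 * OPT * r                                     ∎
        where
        r = √k⁻¹
        t = ι T

theorem3p2p1 : ∀ {c ℓ₁ ℓ₂} (F : EuclideanField c ℓ₁ ℓ₂) →
    let open EuclideanField F
        open ImprovingBandits F in
    (k T : ℕ) .{{_ : NonZero k}} .{{_ : NonZero T}} →
    Σ[ μ ∈ Distribution (Instance k) ]
    Σ[ OPT ∈ Carrier ]
      (∀ j → opt T (outcome μ j) ≈ OPT) ×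
      0# < OPT ×
      (∀ (A : Algorithm k) →
         𝔼 μ (reward T A) ≤ (fromℕ 3 * OPT) / √ (fromℕ k))
theorem3p2p1 F k T =
  uniform k T , OPT k T , (λ j → opt-oneLinear (cap k T) j T) ,
  armTotal-linear-positive T , expected-reward-≤ k T
  where open HardInstances F
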